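{- Let $(L,\vee,\wedge,0,1)$ be a non-trivial complete lattice, let $T$ be a non-empty set, let $H,G\colon L^T\to L^T$ be tense operators on $L$ with time set $T$, and let $R$ denote the relation on $T$ induced by $H$ and $G$. Put $\bar T:=T_1\cup T\cup T_2$ where $T_1:=T\times\{1\}$ and $T_2:=T\times\{2\}$, and $$\bar R:=\{\big((s,1),s\big)\mid s\in T\}\cup R\cup\{\big(s,(s,2)\big)\mid s\in T\}\subseteq\bar T\times\bar T,$$ and let $\bar H,\bar G\colon L^{\bar T}\to L^{\bar T}$ denote the tense operators induced by the time frame $(\bar T,\bar R)$. For every $q\in L^T$ let $\bar q\in L^{\bar T}$ be defined by $$\bar q\big((s,1)\big):=H(q)(s),\quad \bar q(s):=q(s),\quad \bar q\big((s,2)\big):=G(q)(s)\quad\text{for all }s\in T.$$ Then $\bar R|T=R$, and $$\big(\bar H(\bar q)\big)|T=H(q)\quad\text{and}\quad\big(\bar G(\bar q)\big)|T=G(q)$$ for all $q\in L^T$.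
   Context: Tense operators on $L$ with time set $T$ (given abstractly, not from a time frame) are arbitrary maps $L^T\to L^T$, where $L^T$ is the set of all functions $T\to L$. Non-trivial means that $L$ has more than one element; $0$ and $1$ are its least and greatest elements. The sets $T_1$, $T$, $T_2$ are regarded as pairwise disjoint. The relation induced by $H$ and $G$ is $\{(s,t)\in T^2\mid H(q)(t)\leq q(s)\text{ and }G(q)(s)\leq q(t)\text{ for all }q\in L^T\}$. A time frame is a pair $(S,Q)$ of a non-empty set $S$ and a non-empty binary relation $Q$ on $S$. The tense operators $H_Q,G_Q\colon L^S\to L^S$ (playing the roles of $H$ and $G$) induced by $(S,Q)$ are defined, for $q\in L^S$ and $s\in S$, by $H_Q(q)(s):=\bigwedge\{q(t)\mid t\mathrel Q s\}$ and $G_Q(q)(s):=\bigwedge\{q(t)\mid s\mathrel Q t\}$, where the meet of the empty set is $1$. Thus $\bar H=H_{\bar R}$ and $\bar G=G_{\bar R}$ for $S=\bar T$. $\bar R|T$ means $\bar R\cap T^2$, and $f|T$ for $f\in L^{\bar T}$ means the restriction of the function $f$ to $T$. -}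

module Defs where

open import Level using (Level; _⊔_) renaming (suc to lsuc)
open import Data.Product using (_×_; _,_; ∃; ∃₂)
open import Function.Bundles using (Func; _⟨$⟩_)
open import Function.Indexed.Relation.Binary.Equality using (≡-setoid)
open import Relation.Binary.Bundles using (Setoid)
open import Relation.Binary.Core using (Rel)
open import Relation.Binary.Indexed.Heterogeneous.Construct.Trivial using (indexedSetoid)
open import Relation.Binary.Lattice.Bundles using (BoundedLattice)
open import Relation.Nullary.Negation using (¬_)
open import Relation.Unary using (Pred; _∈_)

private
  variable
    c ℓ₁ ℓ₂ p r s t : Level

-- Subsets of the carrier are predicates of level p.  They need not respect _≈_:
-- a predicate and its closure under _≈_ have the same upper and lower bounds.
record CompleteLattice c ℓ₁ ℓ₂ p : Set (lsuc (c ⊔ ℓ₁ ⊔ ℓ₂ ⊔ p)) where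
  field
    boundedLattice : BoundedLattice c ℓ₁ ℓ₂

  open BoundedLattice boundedLattice public

  field
    ⋁          : Pred Carrier p → Carrier
    ⋁-upper    : ∀ P {x} → x ∈ P → x ≤ ⋁ P
    ⋁-least    : ∀ P {y} → (∀ {x} → x ∈ P → x ≤ y) → ⋁ P ≤ y
    ⋀          : Pred Carrier p → Carrier
    ⋀-lower    : ∀ P {x} → x ∈ P → ⋀ P ≤ x
    ⋀-greatest : ∀ P {y} → (∀ {x} → x ∈ P → y ≤ x) → y ≤ ⋀ P

NonTrivial : CompleteLattice c ℓ₁ ℓ₂ p → Set (c ⊔ ℓ₁)
NonTrivial L = ∃₂ λ x y → ¬ (x ≈ y)
  where open CompleteLattice L

-- L^T, with pointwise equality.
infixl 8 _^_
_^_ : CompleteLattice c ℓ₁ ℓ₂ p → (T : Set t) → Setoid (c ⊔ t) (ℓ₁ ⊔ t)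
L ^ T = ≡-setoid T (indexedSetoid (CompleteLattice.setoid L))

-- An arbitrary map L^T → L^T; Func only asks that it be well defined with
-- respect to the equality of L^T.
TenseOperator : CompleteLattice c ℓ₁ ℓ₂ p → (T : Set t) → Set (c ⊔ ℓ₁ ⊔ t)
TenseOperator L T = Func (L ^ T) (L ^ T)

record TimeFrame s r : Set (lsuc (s ⊔ r)) where
  field
    Time              : Set s
    _Q_               : Rel Time r
    Time-nonempty     : Time
    relation-nonempty : ∃₂ λ x y → x Q y

module _ {c ℓ₁ ℓ₂ s r : Level}
         (L : CompleteLattice c ℓ₁ ℓ₂ (ℓ₁ ⊔ s ⊔ r))
         (F : TimeFrame s r) where
  open CompleteLattice L
  open TimeFrame F

  pastValues : (Time → Carrier) → Time → Pred Carrier (ℓ₁ ⊔ s ⊔ r)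
  pastValues q x = λ a → ∃ λ y → y Q x × a ≈ q y

  futureValues : (Time → Carrier) → Time → Pred Carrier (ℓ₁ ⊔ s ⊔ r)
  futureValues q x = λ a → ∃ λ y → x Q y × a ≈ q y

  inducedH : TenseOperator L Time
  inducedH = record
    { to   = λ q x → ⋀ (pastValues q x)
    ; cong = λ {q} {q′} q≈q′ x → antisym
        (⋀-greatest (pastValues q′ x) λ (y , yQx , a≈) →
          ⋀-lower (pastValues q x) (y , yQx , Eq.trans a≈ (Eq.sym (q≈q′ y))))
        (⋀-greatest (pastValues q x) λ (y , yQx , a≈) →
          ⋀-lower (pastValues q′ x) (y , yQx , Eq.trans a≈ (q≈q′ y)))
    }

  inducedG : TenseOperator L Time
  inducedG = record
    { to   = λ q x → ⋀ (futureValues q x)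
    ; cong = λ {q} {q′} q≈q′ x → antisym
        (⋀-greatest (futureValues q′ x) λ (y , xQy , a≈) →
          ⋀-lower (futureValues q x) (y , xQy , Eq.trans a≈ (Eq.sym (q≈q′ y))))
        (⋀-greatest (futureValues q x) λ (y , xQy , a≈) →
          ⋀-lower (futureValues q′ x) (y , xQy , Eq.trans a≈ (q≈q′ y)))
    }

module _ {c ℓ₁ ℓ₂ p t : Level}
         (L : CompleteLattice c ℓ₁ ℓ₂ p) {T : Set t}
         (H G : TenseOperator L T) where
  open CompleteLattice L

  inducedRelation : Rel T (c ⊔ ℓ₂ ⊔ t)
  inducedRelation x y =
    ∀ (q : T → Carrier) → (H ⟨$⟩ q) y ≤ q x × (G ⟨$⟩ q) x ≤ q y

-- The disjoint union of T × {1}, T and T × {2}; ⟨_⟩ is the inclusion of T.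
data Extended (T : Set t) : Set t where
  ⟨_,1⟩ : T → Extended T
  ⟨_⟩   : T → Extended T
  ⟨_,2⟩ : T → Extended T

data ExtendedRel {T : Set t} (R : Rel T r) : Rel (Extended T) (t ⊔ r) where
  past    : ∀ x → ExtendedRel R ⟨ x ,1⟩ ⟨ x ⟩
  present : ∀ {x y} → R x y → ExtendedRel R ⟨ x ⟩ ⟨ y ⟩
  future  : ∀ x → ExtendedRel R ⟨ x ⟩ ⟨ x ,2⟩

extendedFrame : {T : Set t} → T → Rel T r → TimeFrame t (t ⊔ r)
extendedFrame {T = T} x₀ R = record
  { Time              = Extended T
  ; _Q_               = ExtendedRel R
  ; Time-nonempty     = ⟨ x₀ ⟩
  ; relation-nonempty = ⟨ x₀ ,1⟩ , ⟨ x₀ ⟩ , past x₀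
  }

module _ {c ℓ₁ ℓ₂ p t : Level}
         (L : CompleteLattice c ℓ₁ ℓ₂ p) {T : Set t}
         (H G : TenseOperator L T) where
  open CompleteLattice L

  extend : (T → Carrier) → Extended T → Carrier
  extend q ⟨ x ,1⟩ = (H ⟨$⟩ q) x
  extend q ⟨ x ⟩   = q x
  extend q ⟨ x ,2⟩ = (G ⟨$⟩ q) x

{-# OPTIONS --safe #-}
-- The only R̄-predecessors of s ∈ T are (s,1), where q̄ takes the value H(q)(s),
-- and the R-predecessors of s, where q is at least H(q)(s) by the choice of R.
-- Hence the meet defining H̄(q̄)(s) is attained at (s,1); dually, the meet
-- defining Ḡ(q̄)(s) is attained at (s,2).
module Submission where

open import Defs
open import Level using (Level; _⊔_)
open import Data.Product using (_×_; _,_; proj₁; proj₂)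
open import Function.Base using (_∘_; _on_)
open import Function.Bundles using (_⟨$⟩_)
open import Relation.Binary.Bundles using (Setoid)
open import Relation.Binary.Core using (Rel; _⇔_)
open import Relation.Unary using (Pred; _∈_)

private
  variable
    c ℓ₁ ℓ₂ p r t : Level

module _ (L : CompleteLattice c ℓ₁ ℓ₂ p) where
  open CompleteLattice L

  ⋀-attained : ∀ (P : Pred Carrier p) {m} → m ∈ P → (∀ {a} → a ∈ P → m ≤ a) → ⋀ P ≈ m
  ⋀-attained P m∈P m≤ = antisym (⋀-lower P m∈P) (⋀-greatest P m≤)

-- Each `past` or `future` edge has an endpoint outside the copy of `T`, so matching leaves only
-- `present`.
extendedRel-restricts : {T : Set t} (R : Rel T r) → (ExtendedRel R on ⟨_⟩) ⇔ R
extendedRel-restricts R = (λ { (present xRy) → xRy }) , present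

-- `inducedRelation` quantifies over all functions `T → Carrier`, hence has level `c ⊔ ℓ₂ ⊔ t`; the
-- equations in `pastValues` and `futureValues` add `ℓ₁`. Meets must exist for predicates of this
-- size.
module _ (L : CompleteLattice c ℓ₁ ℓ₂ (c ⊔ ℓ₁ ⊔ ℓ₂ ⊔ t))
         {T : Set t} (t₀ : T) (H G : TenseOperator L T) (q : T → CompleteLattice.Carrier L) where
  open CompleteLattice L

  private
    F = extendedFrame t₀ (inducedRelation L H G)
    q̄ = extend L H G q

  inducedH-extend : ∀ x → (inducedH L F ⟨$⟩ q̄) ⟨ x ⟩ ≈ (H ⟨$⟩ q) x
  inducedH-extend x = ⋀-attained L (pastValues L F q̄ ⟨ x ⟩) (_ , past x , Eq.refl) λ where
    (_ , past _ , a≈)      → reflexive (Eq.sym a≈)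
    -- `yRx` speaks of every function; at `q` itself its first half is `H(q)(x) ≤ q(y)`, and `q̄`
    -- agrees with `q` on `T`.
    (_ , present yRx , a≈) → trans (proj₁ (yRx q)) (reflexive (Eq.sym a≈))

  inducedG-extend : ∀ x → (inducedG L F ⟨$⟩ q̄) ⟨ x ⟩ ≈ (G ⟨$⟩ q) x
  inducedG-extend x = ⋀-attained L (futureValues L F q̄ ⟨ x ⟩) (_ , future x , Eq.refl) λ where
    (_ , future _ , a≈)    → reflexive (Eq.sym a≈)
    -- Here the second half at `q` gives `G(q)(x) ≤ q(y)`.
    (_ , present xRy , a≈) → trans (proj₂ (xRy q)) (reflexive (Eq.sym a≈))

theorem5p9 :
    ∀ {c ℓ₁ ℓ₂ t} (L : CompleteLattice c ℓ₁ ℓ₂ (c ⊔ ℓ₁ ⊔ ℓ₂ ⊔ t)) → NonTrivial L →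
    (T : Set t) (t₀ : T) (H G : TenseOperator L T) →
    let R  = inducedRelation L H G
        F  = extendedFrame t₀ R
        R̄  = TimeFrame._Q_ F
        H̄  = inducedH L F
        Ḡ  = inducedG L F
        open CompleteLattice L using (Carrier)
        open Setoid (L ^ T) using (_≈_)
    in ((R̄ on ⟨_⟩) ⇔ R)
       × (∀ (q : T → Carrier) →
            (((H̄ ⟨$⟩ extend L H G q) ∘ ⟨_⟩) ≈ (H ⟨$⟩ q))
          × (((Ḡ ⟨$⟩ extend L H G q) ∘ ⟨_⟩) ≈ (G ⟨$⟩ q)))
theorem5p9 L _ T t₀ H G =
    extendedRel-restricts (inducedRelation L H G)
  , λ q → inducedH-extend L t₀ H G q , inducedG-extend L t₀ H G q
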